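{- There exists a Kolmogorov numbering $\psi$ such that for every computable function $f$ mapping each index $x$ to a finite list of indices containing $\min_\psi(x)$, it holds that $|f(x)|=\Omega(x)$ for infinitely many $x$; that is, there is a constant $c>0$ with $|f(x)|\ge cx$ for infinitely many $x$.
   Context: A numbering $\psi$ is given by a partial-recursive function $U:\mathbb{N}^2\to\mathbb{N}$ via $\psi_e(x)=U(e,x)$. A Kolmogorov numbering is a numbering $\psi$ such that for every numbering $\theta$ there exist a computable function $t$ and a constant $c>0$ with $\psi_{t(e)}=\theta_e$ and $t(e)\le ce+c$ for all $e$. $\min_\psi(e)$ is the least $j$ with $\psi_j=\psi_e$. $|f(x)|$ denotes the number of elements of the list $f(x)$. -}

module Defs where

open import Data.Nat using (ℕ; zero; suc; _+_; _*_; _^_; _≤_; _<_)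
open import Data.Fin using (Fin)
open import Data.Vec using (Vec; []; _∷_; lookup)
open import Data.List using (List; []; _∷_)
open import Data.Product using (Σ; ∃; _×_)
open import Relation.Nullary using (¬_)
open import Function.Bundles using (_⇔_)

data PR : ℕ → Set where
  zeroF : PR 0
  succF : PR 1
  proj  : ∀ {n} → Fin n → PR n
  comp  : ∀ {m n} → PR m → (Fin m → PR n) → PR n
  prec  : ∀ {n} → PR n → PR (suc (suc n)) → PR (suc n)
  mu    : ∀ {n} → PR (suc n) → PR n

data Eval : ∀ {n} → PR n → Vec ℕ n → ℕ → Set where
  e-zero : Eval zeroF [] 0
  e-succ : ∀ {x} → Eval succF (x ∷ []) (suc x)
  e-proj : ∀ {n} {i : Fin n} {xs} → Eval (proj i) xs (lookup xs i)
  e-comp : ∀ {m n} {f : PR m} {gs : Fin m → PR n} {xs} {y} (ys : Vec ℕ m) →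
           (∀ i → Eval (gs i) xs (lookup ys i)) → Eval f ys y → Eval (comp f gs) xs y
  e-prec0 : ∀ {n} {g : PR n} {h : PR (suc (suc n))} {xs} {y} →
            Eval g xs y → Eval (prec g h) (0 ∷ xs) y
  e-precS : ∀ {n} {g : PR n} {h : PR (suc (suc n))} {k xs z y} →
            Eval (prec g h) (k ∷ xs) z → Eval h (k ∷ z ∷ xs) y →
            Eval (prec g h) (suc k ∷ xs) y
  e-mu : ∀ {n} {f : PR (suc n)} {xs} {y} →
         Eval f (y ∷ xs) 0 → (∀ i → i < y → ∃ λ z → Eval f (i ∷ xs) (suc z)) →
         Eval (mu f) xs y

Computable : (ℕ → ℕ) → Set
Computable t = Σ (PR 1) λ p → ∀ x → Eval p (x ∷ []) (t x)

codeList : List ℕ → ℕ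
codeList []       = 0
codeList (x ∷ xs) = 2 ^ x * (2 * codeList xs + 1)

ComputableList : (ℕ → List ℕ) → Set
ComputableList f = Computable (λ x → codeList (f x))

-- A numbering is given by a partial recursive U : ℕ² → ℕ, ψ_e(x) = U(e,x).
Numbering : Set
Numbering = PR 2

_⟦_⟧_↓_ : Numbering → ℕ → ℕ → ℕ → Set
U ⟦ e ⟧ x ↓ y = Eval U (e ∷ x ∷ []) y

SameFn : Numbering → ℕ → Numbering → ℕ → Set
SameFn ψ i θ j = ∀ x y → (ψ ⟦ i ⟧ x ↓ y) ⇔ (θ ⟦ j ⟧ x ↓ y)

IsKolmogorov : Numbering → Set
IsKolmogorov ψ = ∀ (θ : Numbering) → Σ (ℕ → ℕ) λ t → Computable t ×
  (Σ ℕ λ c → 0 < c × (∀ e → SameFn ψ (t e) θ e) × (∀ e → t e ≤ c * e + c))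

IsMin : Numbering → ℕ → ℕ → Set
IsMin ψ e j = SameFn ψ j ψ e × (∀ i → i < j → ¬ SameFn ψ i ψ e)

{-# OPTIONS --safe #-}
module Submission where

-- In ψ the indices 4c + 3 simulate all numberings, even indices j compute the constant j, and an
-- index x = 4(A + b) + 1 with b < A = 2ⁿ belongs to block n, which is devoted to the list function
-- f whose program is the first component of n.  There ψ_x is the constant j_b, the least even
-- number neither in f(x) nor chosen for a smaller b.  If |f(x)| < A throughout the block, then
-- j_b ≤ 4A − 4, so ψ_x = ψ_(j_b), and since j_b ∉ f(x) the index j_b is not minimal.  The only
-- smaller indices that can compute the constant j_b are of the form 4c + 3, and fewer than A of
-- these lie below 4A − 4, whereas the A constants j_b are distinct.

open import Defs
open import Data.Empty using (⊥; ⊥-elim)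
open import Data.Fin using (Fin; zero; suc; toℕ; fromℕ<)
open import Data.Fin.Patterns using (0F; 1F; 2F; 3F)
open import Data.Fin.Properties using (pigeonhole; toℕ<n; fromℕ<-injective)
open import Data.List using (List; []; _∷_; length; _++_; drop)
import Data.List as List
open import Data.List.Membership.Propositional using (_∈_; _∉_)
open import Data.List.Membership.Propositional.Properties using (∈-++⁺ˡ; ∈-++⁺ʳ; ∈-++⁻)
open import Data.List.Properties using (length-++)
open import Data.List.Relation.Unary.Any using (here; there; index)
open import Data.List.Relation.Unary.Any.Properties using (lookup-index)
open import Data.Nat hiding (parity)
open import Data.List.Membership.DecPropositional _≟_ using (_∈?_)
open import Data.Nat.Properties
open import Data.Nat.Tactic.RingSolver using (solve-∀)
open import Data.Product using (Σ; ∃; _×_; _,_; proj₁; proj₂)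
open import Data.Sum using (_⊎_; inj₁; inj₂)
open import Data.Vec using (Vec; []; _∷_; lookup; map)
open import Data.Vec.Properties using (lookup-map)
open import Function using (_∘_; _⇔_; mk⇔; Equivalence)
open import Relation.Binary.Definitions using (tri<; tri≈; tri>)
open import Relation.Binary.PropositionalEquality
open import Relation.Nullary using (¬_; yes; no; contradiction)
open import Relation.Unary using (Decidable)

-- The construction controls the constants and the diagonal indices but not the simulated
-- numberings: some 4c + 3 below j_b may happen to compute the constant j_b, and then f may omit j_b
-- with impunity. A single x therefore proves nothing, and a whole block is played against the
-- scarcity of simulations. The densities serve this count: even numbers are dense enough that
-- avoiding fewer than A list entries and fewer than A earlier choices keeps j_b below 4A, and
-- residue 3 modulo 4 is sparse enough. The factor 8 arises because a block ends below 8A, so that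
-- 8|f(x)| < x gives |f(x)| < A. The second component of n is free, so every f owns blocks beyond
-- any bound. Simulation has linear overhead because the pairing 2^p(2e + 1) is linear in e for
-- fixed p. No fixed-point theorem is needed: `diagonal` receives its own index as an argument.

private variable n : ℕ

-- For `mu`, of two different results the smaller one would give the body both the value 0 and a
-- successor.
Eval-deterministic : ∀ (p : PR n) {xs y z} → Eval p xs y → Eval p xs z → y ≡ z
Eval-deterministic zeroF e-zero e-zero = refl
Eval-deterministic succF e-succ e-succ = refl
Eval-deterministic (proj i) e-proj e-proj = refl
Eval-deterministic (comp f gs) (e-comp ys es e) (e-comp ys′ es′ e′) =
  Eval-deterministic f (subst (λ v → Eval f v _) ys≡ys′ e) e′
  where
  ys≡ys′ : ys ≡ ys′
  lookup-injective : ∀ {m} (us vs : Vec ℕ m) → (∀ i → lookup us i ≡ lookup vs i) → us ≡ vs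
  lookup-injective []       []       _  = refl
  lookup-injective (u ∷ us) (v ∷ vs) eq = cong₂ _∷_ (eq zero) (lookup-injective us vs λ i → eq (suc i))
  ys≡ys′ = lookup-injective ys ys′ λ i → Eval-deterministic (gs i) (es i) (es′ i)
Eval-deterministic (prec g h) (e-prec0 e) (e-prec0 e′) = Eval-deterministic g e e′
Eval-deterministic (prec g h) (e-precS e d) (e-precS e′ d′)
  with refl ← Eval-deterministic (prec g h) e e′ = Eval-deterministic h d d′
Eval-deterministic (mu f) {y = y} {z} (e-mu e below) (e-mu e′ below′) with <-cmp y z
... | tri< y<z _ _ with () ← Eval-deterministic f e (proj₂ (below′ y y<z))
... | tri≈ _ y≡z _ = y≡z
... | tri> _ _ z<y with () ← Eval-deterministic f e′ (proj₂ (below z z<y))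

-- Primitive recursive expressions

record Exp (n : ℕ) : Set where
  constructor exp
  field
    prog : PR n
    ⟦_⟧  : Vec ℕ n → ℕ
    runs : ∀ xs → Eval prog xs (⟦_⟧ xs)

open Exp

var : Fin n → Exp n
var i = exp (proj i) (λ xs → lookup xs i) (λ _ → e-proj)

infixl 9 _$$_

_$$_ : ∀ {m} → Exp m → Vec (Exp n) m → Exp n
f $$ es = exp (comp (prog f) (λ i → prog (lookup es i))) (λ xs → ⟦ f ⟧ (map (λ e → ⟦ e ⟧ xs) es))
  λ xs → e-comp _
    (λ i → subst (Eval _ xs) (sym (lookup-map i (λ e → ⟦ e ⟧ xs) es)) (runs (lookup es i) xs))
    (runs f _)

const : ℕ → Exp n
const zero    = exp zeroF (λ _ → 0) (λ { [] → e-zero }) $$ []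
const (suc k) = exp succF (λ { (x ∷ []) → suc x }) (λ { (x ∷ []) → e-succ }) $$ (const k ∷ [])

⟦const⟧ : ∀ k (xs : Vec ℕ n) → ⟦ const k ⟧ xs ≡ k
⟦const⟧ zero    xs = refl
⟦const⟧ (suc k) xs = cong suc (⟦const⟧ k xs)

primrec : (Vec ℕ n → ℕ) → (Vec ℕ (2 + n) → ℕ) → Vec ℕ (suc n) → ℕ
primrec g h (zero  ∷ xs) = g xs
primrec g h (suc k ∷ xs) = h (k ∷ primrec g h (k ∷ xs) ∷ xs)

rec : Exp n → Exp (2 + n) → Exp (suc n)
rec g h = exp (prec (prog g) (prog h)) (primrec ⟦ g ⟧ ⟦ h ⟧) λ { (k ∷ xs) → rec-runs k xs }
  where
  rec-runs : ∀ k xs → Eval (prec (prog g) (prog h)) (k ∷ xs) (primrec ⟦ g ⟧ ⟦ h ⟧ (k ∷ xs))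
  rec-runs zero    xs = e-prec0 (runs g xs)
  rec-runs (suc k) xs = e-precS (rec-runs k xs) (runs h _)

respec : (e : Exp n) (f : Vec ℕ n → ℕ) → (∀ xs → ⟦ e ⟧ xs ≡ f xs) → Exp n
respec e f eq = exp (prog e) f λ xs → subst (Eval (prog e) xs) (eq xs) (runs e xs)

runs-at : ∀ (e : Exp n) xs {y} → ⟦ e ⟧ xs ≡ y → Eval (prog e) xs y
runs-at e xs refl = runs e xs

Computable₂ : (ℕ → ℕ → ℕ) → Set
Computable₂ f = Σ (PR 2) λ p → ∀ x y → Eval p (x ∷ y ∷ []) (f x y)

infixl 9 _·_
_·_ : ∀ {f} → Computable f → Exp n → Exp n
_·_ {f = f} (p , ok) a = exp p (λ { (x ∷ []) → f x }) (λ { (x ∷ []) → ok x }) $$ (a ∷ [])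

_·₂_,_ : ∀ {f} → Computable₂ f → Exp n → Exp n → Exp n
_·₂_,_ {f = f} (p , ok) a b =
  exp p (λ { (x ∷ y ∷ []) → f x y }) (λ { (x ∷ y ∷ []) → ok x y }) $$ (a ∷ b ∷ [])

computable : ∀ {f} (e : Exp 1) → (∀ x → ⟦ e ⟧ (x ∷ []) ≡ f x) → Computable f
computable e eq = prog e , λ x → subst (Eval _ _) (eq x) (runs e _)

computable₂ : ∀ {f} (e : Exp 2) → (∀ x y → ⟦ e ⟧ (x ∷ y ∷ []) ≡ f x y) → Computable₂ f
computable₂ e eq = prog e , λ x y → subst (Eval _ _) (eq x y) (runs e _)

suc-computable : Computable suc
suc-computable = succF , λ _ → e-succ

pred-computable : Computable pred
pred-computable = computable (rec (const 0) (var 0F)) λ { zero → refl ; (suc _) → refl }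

+-computable : Computable₂ _+_
+-computable = computable₂ (rec (var 0F) (suc-computable · var 1F)) +-eq
  where
  +-eq : ∀ x y → _
  +-eq zero    y = refl
  +-eq (suc x) y = cong suc (+-eq x y)

∸-computable : Computable₂ _∸_
∸-computable = computable₂ (rec (var 0F) (pred-computable · var 1F) $$ (var 1F ∷ var 0F ∷ [])) ∸-eq
  where
  ∸-eq : ∀ x y → _
  ∸-eq x zero    = refl
  ∸-eq x (suc y) = trans (cong pred (∸-eq x y)) (pred[m∸n]≡m∸[1+n] x y)

ifz : ℕ → ℕ → ℕ → ℕ
ifz zero    x y = x
ifz (suc _) x y = y

if-zero : Exp n → Exp n → Exp n → Exp n
if-zero c a b = respec (rec (var 0F) (var 3F))
  (λ { (c ∷ x ∷ y ∷ []) → ifz c x y })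
  (λ { (zero ∷ _ ∷ _ ∷ []) → refl ; (suc _ ∷ _ ∷ _ ∷ []) → refl })
  $$ (c ∷ a ∷ b ∷ [])

-- Arithmetic and pairing

double : ℕ → ℕ
double zero    = zero
double (suc n) = suc (suc (double n))

parity : ℕ → ℕ
parity zero    = 0
parity (suc n) = ifz (parity n) 1 0

half : ℕ → ℕ
half zero    = 0
half (suc n) = ifz (parity n) (half n) (suc (half n))

double-computable : Computable double
double-computable = computable (rec (const 0) (suc-computable · (suc-computable · var 1F))) eq
  where
  eq : ∀ x → _
  eq zero    = refl
  eq (suc x) = cong (λ z → suc (suc z)) (eq x)

parity-computable : Computable parity
parity-computable = computable (rec (const 0) (if-zero (var 1F) (const 1) (const 0))) eq
  where
  eq : ∀ x → _
  eq zero    = refl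
  eq (suc x) = cong (λ z → ifz z 1 0) (eq x)

half-computable : Computable half
half-computable =
  computable (rec (const 0) (if-zero (parity-computable · var 0F) (var 1F) (suc-computable · var 1F))) eq
  where
  eq : ∀ x → _
  eq zero    = refl
  eq (suc x) = cong (λ z → ifz (parity x) z (suc z)) (eq x)

double≡2* : ∀ n → double n ≡ 2 * n
double≡2* zero    = refl
double≡2* (suc n) = cong suc (trans (cong suc (double≡2* n)) (sym (+-suc n (n + 0))))

parity-double : ∀ n → parity (double n) ≡ 0
parity-double zero    = refl
parity-double (suc n) rewrite parity-double n = refl

parity-1+double : ∀ n → parity (suc (double n)) ≡ 1
parity-1+double n rewrite parity-double n = refl

half-1+double : ∀ n → half (suc (double n)) ≡ n
half-double : ∀ n → half (double n) ≡ n
half-double zero    = refl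
half-double (suc n) rewrite parity-1+double n = cong suc (half-1+double n)
half-1+double n rewrite parity-double n = half-double n

bisect : ∀ n → Σ ℕ λ k → n ≡ double k ⊎ n ≡ suc (double k)
bisect zero = 0 , inj₁ refl
bisect (suc n) with bisect n
... | k , inj₁ eq = k , inj₂ (cong suc eq)
... | k , inj₂ eq = suc k , inj₁ (cong suc eq)

double-mono-≤ : ∀ {m n} → m ≤ n → double m ≤ double n
double-mono-≤ z≤n       = z≤n
double-mono-≤ (s≤s m≤n) = s≤s (s≤s (double-mono-≤ m≤n))

n≤double : ∀ n → n ≤ double n
n≤double zero    = z≤n
n≤double (suc n) = s≤s (m≤n⇒m≤1+n (n≤double n))

double-injective : ∀ {m n} → double m ≡ double n → m ≡ n
double-injective {m} {n} eq = trans (sym (half-double m)) (trans (cong half eq) (half-double n))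

shift : ℕ → ℕ → ℕ
shift n zero    = n
shift n (suc i) = half (shift n i)

shift-computable : Computable₂ shift
shift-computable = computable₂ (rec (var 0F) (half-computable · var 1F) $$ (var 1F ∷ var 0F ∷ [])) eq
  where
  eq : ∀ x i → _
  eq x zero    = refl
  eq x (suc i) = cong half (eq x i)

-- min (i, the number of trailing binary zeros of n)
zeros : ℕ → ℕ → ℕ
zeros n zero    = 0
zeros n (suc i) = ifz (parity (shift n (zeros n i))) (suc (zeros n i)) (zeros n i)

zeros-computable : Computable₂ zeros
zeros-computable = computable₂ (rec (const 0)
  (if-zero (parity-computable · (shift-computable ·₂ var 2F , var 1F)) (suc-computable · var 1F) (var 1F))
  $$ (var 1F ∷ var 0F ∷ [])) eq
  where
  eq : ∀ x i → _
  eq x zero    = refl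
  eq x (suc i) = cong (λ z → ifz (parity (shift x z)) (suc z) z) (eq x i)

-- The pairing behind codeList.  Opacity, here and below, keeps Agda from evaluating program codes,
-- which are huge numerals.
opaque
  cons : ℕ → ℕ → ℕ
  cons zero    y = suc (double y)
  cons (suc x) y = double (cons x y)

  -- A positive n has fewer than n trailing zeros, so the cap n never interferes.
  hd : ℕ → ℕ
  hd n = zeros n n

  tl : ℕ → ℕ
  tl n = half (shift n (hd n))

  cons-computable : Computable₂ cons
  cons-computable = computable₂ consExp eq
    where
    consExp : Exp 2
    consExp = rec (suc-computable · (double-computable · var 0F)) (double-computable · var 1F)
    eq : ∀ x y → ⟦ consExp ⟧ (x ∷ y ∷ []) ≡ cons x y
    eq zero    y = refl
    eq (suc x) y = cong double (eq x y)

  hd-computable : Computable hd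
  hd-computable = computable (zeros-computable ·₂ var 0F , var 0F) λ _ → refl

  tl-computable : Computable tl
  tl-computable = computable (half-computable · (shift-computable ·₂ var 0F , (hd-computable · var 0F))) λ _ → refl

  cons≡ : ∀ x y → cons x y ≡ 2 ^ x * (2 * y + 1)
  cons≡ zero    y = trans (cong suc (double≡2* y)) (trans (+-comm 1 (2 * y)) (sym (+-identityʳ _)))
  cons≡ (suc x) y = trans (double≡2* (cons x y)) (trans (cong (2 *_) (cons≡ x y)) (sym (*-assoc 2 (2 ^ x) _)))

  cons-suc : ∀ x y → cons (suc x) y ≡ double (cons x y)
  cons-suc x y = refl

  tl-0 : tl 0 ≡ 0
  tl-0 = refl

  -- This growth keeps 0 free for the empty list and the empty stack, bounds list lengths by their
  -- codes, and pushes blocks past any given number.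
  x+y<cons : ∀ x y → x + y < cons x y
  x+y<cons zero    y = s≤s (n≤double y)
  x+y<cons (suc x) y = <-≤-trans (s≤s (x+y<cons x y)) (1+n≤double (<-≤-trans z<s (x+y<cons x y)))
    where
    1+n≤double : ∀ {n} → 0 < n → suc n ≤ double n
    1+n≤double {suc n} _ = s≤s (s≤s (n≤double n))

  shift-cons : ∀ i d y → shift (cons (i + d) y) i ≡ cons d y
  shift-cons zero    d y = refl
  shift-cons (suc i) d y = begin
    half (shift (cons (suc i + d) y) i)   ≡⟨ cong (λ z → half (shift (cons z y) i)) (sym (+-suc i d)) ⟩
    half (shift (cons (i + suc d) y) i)   ≡⟨ cong half (shift-cons i (suc d) y) ⟩
    half (double (cons d y))              ≡⟨ half-double _ ⟩
    cons d y                              ∎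
    where open ≡-Reasoning

  zeros-cons-≤ : ∀ i d y → zeros (cons (i + d) y) i ≡ i
  zeros-cons-≤ zero    d y = refl
  zeros-cons-≤ (suc i) d y = subst (λ z → zeros (cons z y) (suc i) ≡ suc i) (+-suc i d) step-zeros
    where
    step-zeros : zeros (cons (i + suc d) y) (suc i) ≡ suc i
    step-zeros rewrite zeros-cons-≤ i (suc d) y | shift-cons i (suc d) y | parity-double (cons d y) = refl

  zeros-cons-≥ : ∀ x y d → zeros (cons x y) (d + x) ≡ x
  zeros-cons-≥ x y zero = subst (λ z → zeros (cons z y) x ≡ x) (+-identityʳ x) (zeros-cons-≤ x 0 y)
  zeros-cons-≥ x y (suc d)
    rewrite zeros-cons-≥ x y d
    | trans (cong (λ z → shift (cons z y) x) (sym (+-identityʳ x))) (shift-cons x 0 y)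
    | parity-double y = refl

  x<cons : ∀ x y → x < cons x y
  x<cons x y = ≤-<-trans (m≤m+n x y) (x+y<cons x y)

  hd-cons : ∀ x y → hd (cons x y) ≡ x
  hd-cons x y = subst (λ k → zeros (cons x y) k ≡ x) (m∸n+n≡m (<⇒≤ (x<cons x y))) (zeros-cons-≥ x y (cons x y ∸ x))

  tl-cons : ∀ x y → tl (cons x y) ≡ y
  tl-cons x y = begin
    half (shift (cons x y) (hd (cons x y)))  ≡⟨ cong (λ z → half (shift (cons x y) z)) (hd-cons x y) ⟩
    half (shift (cons x y) x)                ≡⟨ cong (λ z → half (shift (cons z y) x)) (sym (+-identityʳ x)) ⟩
    half (shift (cons (x + 0) y) x)          ≡⟨ cong half (shift-cons x 0 y) ⟩
    half (suc (double y))                    ≡⟨ half-1+double y ⟩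
    y                                        ∎
    where open ≡-Reasoning

cons≢0 : ∀ x y → cons x y ≢ 0
cons≢0 x y = >⇒≢ (≤-<-trans z≤n (x+y<cons x y))

cons′ : Exp n → Exp n → Exp n
cons′ a b = cons-computable ·₂ a , b

hd′ tl′ suc′ pred′ : Exp n → Exp n
hd′ a   = hd-computable · a
tl′ a   = tl-computable · a
suc′ a  = suc-computable · a
pred′ a = pred-computable · a

-- A universal program

switch : Exp n → List (Exp n) → Exp n
switch t []       = const 0
switch t (b ∷ bs) = if-zero t b (switch (pred′ t) bs)

-- A tuple of programs is itself a program: nested pair evaluations under tag 5, ended by tag 0,
-- whose result 0 encodes the empty vector.
code-vec : ∀ {m} → (Fin m → ℕ) → ℕ
code-vec {zero}  c = cons 0 0
code-vec {suc m} c = cons 5 (cons (c zero) (code-vec (c ∘ suc)))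

code-proj : ∀ {n} → Fin n → ℕ
code-proj zero    = cons 2 0
code-proj (suc i) = cons 3 (code-proj i)

-- Every code has the form `cons t d`, so it serves directly as a stack frame.
code : PR n → ℕ
code zeroF       = cons 0 0
code succF       = cons 1 0
code (proj i)    = code-proj i
code (comp f gs) = cons 4 (cons (code-vec (λ i → code (gs i))) (code f))
code (prec g h)  = cons 8 (cons (code g) (code h))
code (mu f)      = cons 10 (code f)

encode : Vec ℕ n → ℕ
encode []       = 0
encode (x ∷ xs) = cons x (encode xs)

-- A stack machine: a configuration cons k v consists of a stack k of frames and a value v,
-- and the topmost frame cons t d (tag t, data d) acts on v.  Tags 6, 7 continue tag 5
-- (evaluation of a pair), tag 9 continues tag 8 (prec), tag 11 continues tag 10 (mu).
act : ℕ → ℕ → ℕ → ℕ → ℕ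
act 0  d k v = cons k 0
act 1  d k v = cons k (suc (hd v))
act 2  d k v = cons k (hd v)
act 3  d k v = cons (cons d k) (tl v)
act 4  d k v = cons (cons (hd d) (cons (tl d) k)) v
act 5  d k v = cons (cons (hd d) (cons (cons 6 (cons (tl d) v)) k)) v
act 6  d k v = cons (cons (hd d) (cons (cons 7 v) k)) (tl d)
act 7  d k v = cons k (cons d v)
act 8  d k v = ifz (hd v)
  (cons (cons (hd d) k) (tl v))
  (cons (cons (cons 8 d) (cons (cons 9 (cons (tl d) (cons (pred (hd v)) (tl v)))) k)) (cons (pred (hd v)) (tl v)))
act 9  d k v = cons (cons (hd d) k) (cons (hd (tl d)) (cons v (tl (tl d))))
act 10 d k v = cons (cons d (cons (cons 11 (cons d (cons 0 v))) k)) (cons 0 v)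
act 11 d k v = ifz v
  (cons k (hd (tl d)))
  (cons (cons (hd d) (cons (cons 11 (cons (hd d) (cons (suc (hd (tl d))) (tl (tl d))))) k))
        (cons (suc (hd (tl d))) (tl (tl d))))
act _  d k v = 0

Computable₄ : (ℕ → ℕ → ℕ → ℕ → ℕ) → Set
Computable₄ f = Σ (PR 4) λ p → ∀ x y z w → Eval p (x ∷ y ∷ z ∷ w ∷ []) (f x y z w)

_·₄_,_,_,_ : ∀ {f} → Computable₄ f → Exp n → Exp n → Exp n → Exp n → Exp n
_·₄_,_,_,_ {f = f} (p , ok) a b c d =
  exp p (λ { (x ∷ y ∷ z ∷ w ∷ []) → f x y z w }) (λ { (x ∷ y ∷ z ∷ w ∷ []) → ok x y z w }) $$ (a ∷ b ∷ c ∷ d ∷ [])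

opaque
  act-computable : Computable₄ act
  act-computable = prog actExp , λ t d k v → subst (Eval _ _) (eq t d k v) (runs actExp _)
    where
    d k v : Exp 4
    d = var 1F
    k = var 2F
    v = var 3F
    actExp : Exp 4
    actExp = switch (var 0F)
      ( cons′ k (const 0)
      ∷ cons′ k (suc′ (hd′ v))
      ∷ cons′ k (hd′ v)
      ∷ cons′ (cons′ d k) (tl′ v)
      ∷ cons′ (cons′ (hd′ d) (cons′ (tl′ d) k)) v
      ∷ cons′ (cons′ (hd′ d) (cons′ (cons′ (const 6) (cons′ (tl′ d) v)) k)) v
      ∷ cons′ (cons′ (hd′ d) (cons′ (cons′ (const 7) v) k)) (tl′ d)
      ∷ cons′ k (cons′ d v)
      ∷ if-zero (hd′ v)
          (cons′ (cons′ (hd′ d) k) (tl′ v))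
          (cons′ (cons′ (cons′ (const 8) d)
                   (cons′ (cons′ (const 9) (cons′ (tl′ d) (cons′ (pred′ (hd′ v)) (tl′ v)))) k))
                 (cons′ (pred′ (hd′ v)) (tl′ v)))
      ∷ cons′ (cons′ (hd′ d) k) (cons′ (hd′ (tl′ d)) (cons′ v (tl′ (tl′ d))))
      ∷ cons′ (cons′ d (cons′ (cons′ (const 11) (cons′ d (cons′ (const 0) v))) k)) (cons′ (const 0) v)
      ∷ if-zero v
          (cons′ k (hd′ (tl′ d)))
          (cons′ (cons′ (hd′ d)
                   (cons′ (cons′ (const 11) (cons′ (hd′ d) (cons′ (suc′ (hd′ (tl′ d))) (tl′ (tl′ d))))) k))
                 (cons′ (suc′ (hd′ (tl′ d))) (tl′ (tl′ d))))
      ∷ [])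
    eq : ∀ t d k v → ⟦ actExp ⟧ (t ∷ d ∷ k ∷ v ∷ []) ≡ act t d k v
    eq 0  d k v = refl
    eq 1  d k v = refl
    eq 2  d k v = refl
    eq 3  d k v = refl
    eq 4  d k v = refl
    eq 5  d k v = refl
    eq 6  d k v = refl
    eq 7  d k v = refl
    eq 8  d k v = refl
    eq 9  d k v = refl
    eq 10 d k v = refl
    eq 11 d k v = refl
    eq (suc (suc (suc (suc (suc (suc (suc (suc (suc (suc (suc (suc _)))))))))))) d k v = refl

step : ℕ → ℕ
step s = act (hd (hd (hd s))) (tl (hd (hd s))) (tl (hd s)) (tl s)

opaque
  step-computable : Computable step
  step-computable = computable
    (act-computable ·₄ hd′ (hd′ (hd′ s)) , tl′ (hd′ (hd′ s)) , tl′ (hd′ s) , tl′ s) λ _ → refl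
    where
    s : Exp 1
    s = var 0F

step-cons : ∀ t d k v → step (cons (cons (cons t d) k) v) ≡ act t d k v
step-cons t d k v
  rewrite hd-cons (cons (cons t d) k) v | tl-cons (cons (cons t d) k) v
        | hd-cons (cons t d) k | tl-cons (cons t d) k | hd-cons t d | tl-cons t d = refl

-- As `hd` and `tl` are opaque, no transition computes by itself; this family of equations does the
-- decoding once for each tag and case.
step-0 : ∀ d k v → step (cons (cons (cons 0 d) k) v) ≡ cons k 0
step-0 = step-cons 0

step-1 : ∀ d k x w → step (cons (cons (cons 1 d) k) (cons x w)) ≡ cons k (suc x)
step-1 d k x w = trans (step-cons 1 d k _) (cong (λ z → cons k (suc z)) (hd-cons x w))

step-2 : ∀ d k x w → step (cons (cons (cons 2 d) k) (cons x w)) ≡ cons k x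
step-2 d k x w = trans (step-cons 2 d k _) (cong (cons k) (hd-cons x w))

step-3 : ∀ d k x w → step (cons (cons (cons 3 d) k) (cons x w)) ≡ cons (cons d k) w
step-3 d k x w = trans (step-cons 3 d k _) (cong (cons (cons d k)) (tl-cons x w))

step-4 : ∀ g f k v → step (cons (cons (cons 4 (cons g f)) k) v) ≡ cons (cons g (cons f k)) v
step-4 g f k v = trans (step-cons 4 _ k v) eq
  where
  eq : act 4 (cons g f) k v ≡ _
  eq rewrite hd-cons g f | tl-cons g f = refl

step-5 : ∀ g f k v →
  step (cons (cons (cons 5 (cons g f)) k) v) ≡ cons (cons g (cons (cons 6 (cons f v)) k)) v
step-5 g f k v = trans (step-cons 5 _ k v) eq
  where
  eq : act 5 (cons g f) k v ≡ _
  eq rewrite hd-cons g f | tl-cons g f = refl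

step-6 : ∀ f w k v → step (cons (cons (cons 6 (cons f w)) k) v) ≡ cons (cons f (cons (cons 7 v) k)) w
step-6 f w k v = trans (step-cons 6 _ k v) eq
  where
  eq : act 6 (cons f w) k v ≡ _
  eq rewrite hd-cons f w | tl-cons f w = refl

step-7 : ∀ d k v → step (cons (cons (cons 7 d) k) v) ≡ cons k (cons d v)
step-7 = step-cons 7

step-8-zero : ∀ g h k w → step (cons (cons (cons 8 (cons g h)) k) (cons 0 w)) ≡ cons (cons g k) w
step-8-zero g h k w = trans (step-cons 8 _ k _) eq
  where
  eq : act 8 (cons g h) k (cons 0 w) ≡ _
  eq rewrite hd-cons g h | hd-cons 0 w | tl-cons 0 w = refl

step-8-suc : ∀ g h k i w → step (cons (cons (cons 8 (cons g h)) k) (cons (suc i) w)) ≡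
  cons (cons (cons 8 (cons g h)) (cons (cons 9 (cons h (cons i w))) k)) (cons i w)
step-8-suc g h k i w = trans (step-cons 8 _ k _) eq
  where
  eq : act 8 (cons g h) k (cons (suc i) w) ≡ _
  eq rewrite tl-cons g h | hd-cons (suc i) w | tl-cons (suc i) w = refl

step-9 : ∀ h i w k v →
  step (cons (cons (cons 9 (cons h (cons i w))) k) v) ≡ cons (cons h k) (cons i (cons v w))
step-9 h i w k v = trans (step-cons 9 _ k v) eq
  where
  eq : act 9 (cons h (cons i w)) k v ≡ _
  eq rewrite hd-cons h (cons i w) | tl-cons h (cons i w) | hd-cons i w | tl-cons i w = refl

step-10 : ∀ f k w → step (cons (cons (cons 10 f) k) w) ≡
  cons (cons f (cons (cons 11 (cons f (cons 0 w))) k)) (cons 0 w)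
step-10 = step-cons 10

step-11-zero : ∀ f i w k → step (cons (cons (cons 11 (cons f (cons i w))) k) 0) ≡ cons k i
step-11-zero f i w k = trans (step-cons 11 _ k 0) eq
  where
  eq : act 11 (cons f (cons i w)) k 0 ≡ _
  eq rewrite tl-cons f (cons i w) | hd-cons i w = refl

step-11-suc : ∀ f i w k v → step (cons (cons (cons 11 (cons f (cons i w))) k) (suc v)) ≡
  cons (cons f (cons (cons 11 (cons f (cons (suc i) w))) k)) (cons (suc i) w)
step-11-suc f i w k v = trans (step-cons 11 _ k (suc v)) eq
  where
  eq : act 11 (cons f (cons i w)) k (suc v) ≡ _
  eq rewrite hd-cons f (cons i w) | tl-cons f (cons i w) | hd-cons i w | tl-cons i w = refl

-- Soundness of the stack machine

data Halts : ℕ → ℕ → ℕ → Set where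
  halt : ∀ {s} → hd s ≡ 0 → Halts 0 s (tl s)
  tick : ∀ {t s r} → hd s ≢ 0 → Halts t (step s) r → Halts (suc t) s r

hd-running : ∀ {F k v} → hd (cons (cons F k) v) ≢ 0
hd-running {F} {k} {v} eq = cons≢0 F k (trans (sym (hd-cons (cons F k) v)) eq)

Halts-step⁻¹ : ∀ {t F k v s r} → step (cons (cons F k) v) ≡ s → Halts t (cons (cons F k) v) r →
  Σ ℕ λ t′ → t′ < t × Halts t′ s r
Halts-step⁻¹ refl (halt eq)  = contradiction eq hd-running
Halts-step⁻¹ refl (tick _ h) = _ , ≤-refl , h

-- The stack k below the frame is arbitrary, so that frames can be chained; the bound `t′ ≤ t` makes
-- the remaining running time a termination measure.
Returns : ℕ → ℕ → (ℕ → Set) → Set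
Returns F v P = ∀ {t k r} → Halts t (cons (cons F k) v) r →
  Σ ℕ λ y → P y × Σ ℕ λ t′ → t′ ≤ t × Halts t′ (cons k y) r

proj-sound : ∀ {t k r} (i : Fin n) xs → Halts t (cons (cons (code-proj i) k) (encode xs)) r →
  Σ ℕ λ t′ → t′ ≤ t × Halts t′ (cons k (lookup xs i)) r
proj-sound zero (x ∷ xs) H with t₁ , t₁< , H₁ ← Halts-step⁻¹ (step-2 _ _ _ _) H = t₁ , <⇒≤ t₁< , H₁
proj-sound (suc i) (x ∷ xs) H
  with t₁ , t₁< , H₁ ← Halts-step⁻¹ (step-3 _ _ _ _) H
  with t₂ , t₂≤ , H₂ ← proj-sound i xs H₁ = t₂ , ≤-trans t₂≤ (<⇒≤ t₁<) , H₂

args-sound : ∀ {m} (gs : Fin m → PR n) {xs} → (∀ i → Returns (code (gs i)) (encode xs) (Eval (gs i) xs)) →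
  Returns (code-vec (λ i → code (gs i))) (encode xs)
    λ w → Σ (Vec ℕ m) λ ys → w ≡ encode ys × ∀ i → Eval (gs i) xs (lookup ys i)
args-sound {m = zero} gs gs-sound H with t₁ , t₁< , H₁ ← Halts-step⁻¹ (step-0 _ _ _) H =
  0 , ([] , refl , λ ()) , t₁ , <⇒≤ t₁< , H₁
args-sound {m = suc m} gs gs-sound H
  with t₁ , t₁< , H₁ ← Halts-step⁻¹ (step-5 _ _ _ _) H
  with y , e , t₂ , t₂≤ , H₂ ← gs-sound zero H₁
  with t₃ , t₃< , H₃ ← Halts-step⁻¹ (step-6 _ _ _ _) H₂
  with _ , (ys , refl , es) , t₄ , t₄≤ , H₄ ← args-sound (gs ∘ suc) (λ i → gs-sound (suc i)) H₃
  with t₅ , t₅< , H₅ ← Halts-step⁻¹ (step-7 _ _ _) H₄ =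
  _ , (y ∷ ys , refl , λ { zero → e ; (suc i) → es i }) , t₅ ,
  ≤-trans (<⇒≤ t₅<) (≤-trans t₄≤ (≤-trans (<⇒≤ t₃<) (≤-trans t₂≤ (<⇒≤ t₁<)))) , H₅

prec-sound : ∀ (g : PR n) h {xs} → Returns (code g) (encode xs) (Eval g xs) →
  (∀ i z → Returns (code h) (encode (i ∷ z ∷ xs)) (Eval h (i ∷ z ∷ xs))) →
  ∀ i → Returns (code (prec g h)) (encode (i ∷ xs)) (Eval (prec g h) (i ∷ xs))
prec-sound g h g-sound h-sound zero H
  with t₁ , t₁< , H₁ ← Halts-step⁻¹ (step-8-zero _ _ _ _) H
  with y , e , t₂ , t₂≤ , H₂ ← g-sound H₁ =
  y , e-prec0 e , t₂ , ≤-trans t₂≤ (<⇒≤ t₁<) , H₂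
prec-sound g h g-sound h-sound (suc i) H
  with t₁ , t₁< , H₁ ← Halts-step⁻¹ (step-8-suc _ _ _ _ _) H
  with z , e , t₂ , t₂≤ , H₂ ← prec-sound g h g-sound h-sound i H₁
  with t₃ , t₃< , H₃ ← Halts-step⁻¹ (step-9 _ _ _ _ _) H₂
  with y , e′ , t₄ , t₄≤ , H₄ ← h-sound i z H₃ =
  y , e-precS e e′ , t₄ , ≤-trans t₄≤ (≤-trans (<⇒≤ t₃<) (≤-trans t₂≤ (<⇒≤ t₁<))) , H₄

-- An unbounded search offers no structural recursion, so `fuel` bounds the remaining time; each
-- failed test costs at least the step under tag 11.
mu-sound : ∀ (f : PR (suc n)) {xs} → (∀ i → Returns (code f) (encode (i ∷ xs)) (Eval f (i ∷ xs))) →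
  ∀ fuel {t k r} i → (∀ j → j < i → ∃ λ z → Eval f (j ∷ xs) (suc z)) → t ≤ fuel →
  Halts t (cons (cons (code f) (cons (cons 11 (cons (code f) (cons i (encode xs)))) k)) (encode (i ∷ xs))) r →
  Σ ℕ λ y → Eval (mu f) xs y × Σ ℕ λ t′ → t′ ≤ t × Halts t′ (cons k y) r
mu-sound f {xs} f-sound fuel i below t≤ H with f-sound i H
... | zero , e , t₁ , t₁≤ , H₁ with t₂ , t₂< , H₂ ← Halts-step⁻¹ (step-11-zero _ _ _ _) H₁ =
  i , e-mu e below , t₂ , ≤-trans (<⇒≤ t₂<) t₁≤ , H₂
... | suc z , e , t₁ , t₁≤ , H₁ with t₂ , t₂< , H₂ ← Halts-step⁻¹ (step-11-suc _ _ _ _ _) H₁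
  with fuel | ≤-trans t₂< (≤-trans t₁≤ t≤)
... | suc fuel | s≤s t₂≤fuel =
  let y , e′ , t₃ , t₃≤ , H₃ = mu-sound f f-sound fuel (suc i) below′ t₂≤fuel H₂
  in y , e′ , t₃ , ≤-trans t₃≤ (≤-trans (<⇒≤ t₂<) t₁≤) , H₃
  where
  below′ : ∀ j → j < suc i → ∃ λ z → Eval f (j ∷ xs) (suc z)
  below′ j (s≤s j≤i) with m≤n⇒m<n∨m≡n j≤i
  ... | inj₁ j<i  = below j j<i
  ... | inj₂ refl = z , e

code-sound : ∀ (p : PR n) xs → Returns (code p) (encode xs) (Eval p xs)
code-sound zeroF [] H with t₁ , t₁< , H₁ ← Halts-step⁻¹ (step-0 _ _ _) H = 0 , e-zero , t₁ , <⇒≤ t₁< , H₁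
code-sound succF (x ∷ []) H with t₁ , t₁< , H₁ ← Halts-step⁻¹ (step-1 _ _ _ _) H =
  suc x , e-succ , t₁ , <⇒≤ t₁< , H₁
code-sound (proj i) xs H with t₁ , t₁≤ , H₁ ← proj-sound i xs H = _ , e-proj , t₁ , t₁≤ , H₁
code-sound (comp f gs) xs H
  with t₁ , t₁< , H₁ ← Halts-step⁻¹ (step-4 _ _ _ _) H
  with _ , (ys , refl , es) , t₂ , t₂≤ , H₂ ← args-sound gs (λ i → code-sound (gs i) xs) H₁
  with y , e , t₃ , t₃≤ , H₃ ← code-sound f ys H₂ =
  y , e-comp ys es e , t₃ , ≤-trans t₃≤ (≤-trans t₂≤ (<⇒≤ t₁<)) , H₃
code-sound (prec g h) (i ∷ xs) = prec-sound g h (code-sound g xs) (λ j z → code-sound h (j ∷ z ∷ xs)) i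
code-sound (mu f) xs H
  with t₁ , t₁< , H₁ ← Halts-step⁻¹ (step-10 _ _ _) H
  with y , e , t₂ , t₂≤ , H₂ ← mu-sound f (λ i → code-sound f (i ∷ xs)) _ 0 (λ _ ()) ≤-refl H₁ =
  y , e , t₂ , ≤-trans t₂≤ (<⇒≤ t₁<) , H₂

-- Completeness of the stack machine

_⇓_ : ℕ → ℕ → Set
s ⇓ r = ∃ λ t → Halts t s r

⇓-step : ∀ {F k v s r} → step (cons (cons F k) v) ≡ s → s ⇓ r → cons (cons F k) v ⇓ r
⇓-step refl (t , H) = suc t , tick hd-running H

-- In continuation form: the steps for `p` are put in front of a given run of the remaining stack,
-- so no step counts have to be added.
code-complete : ∀ (p : PR n) {xs y k r} → Eval p xs y → cons k y ⇓ r → cons (cons (code p) k) (encode xs) ⇓ r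
code-complete zeroF e-zero D = ⇓-step (step-0 _ _ _) D
code-complete succF e-succ D = ⇓-step (step-1 _ _ _ _) D
code-complete (proj i) {xs} e-proj D = proj-complete i xs D
  where
  proj-complete : ∀ {n k r} (i : Fin n) xs → cons k (lookup xs i) ⇓ r → cons (cons (code-proj i) k) (encode xs) ⇓ r
  proj-complete zero    (x ∷ xs) D = ⇓-step (step-2 _ _ _ _) D
  proj-complete (suc i) (x ∷ xs) D = ⇓-step (step-3 _ _ _ _) (proj-complete i xs D)
code-complete {n} (comp f gs) {xs} (e-comp ys es e) D =
  ⇓-step (step-4 _ _ _ _) (args-complete gs ys (λ i → code-complete (gs i) (es i)) (code-complete f e D))
  where
  args-complete : ∀ {m k r} (gs : Fin m → PR n) ys →
    (∀ i {k r} → cons k (lookup ys i) ⇓ r → cons (cons (code (gs i)) k) (encode xs) ⇓ r) →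
    cons k (encode ys) ⇓ r → cons (cons (code-vec (λ i → code (gs i))) k) (encode xs) ⇓ r
  args-complete gs []       gs-complete D = ⇓-step (step-0 _ _ _) D
  args-complete gs (y ∷ ys) gs-complete D =
    ⇓-step (step-5 _ _ _ _) (gs-complete zero (⇓-step (step-6 _ _ _ _)
      (args-complete (gs ∘ suc) ys (λ i → gs-complete (suc i)) (⇓-step (step-7 _ _ _) D))))
code-complete (prec g h) {i ∷ xs} e D = loop i e D
  where
  loop : ∀ i {y k r} → Eval (prec g h) (i ∷ xs) y → cons k y ⇓ r →
    cons (cons (code (prec g h)) k) (encode (i ∷ xs)) ⇓ r
  loop zero    (e-prec0 e)    D = ⇓-step (step-8-zero _ _ _ _) (code-complete g e D)
  loop (suc i) (e-precS e e′) D =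
    ⇓-step (step-8-suc _ _ _ _ _) (loop i e (⇓-step (step-9 _ _ _ _ _) (code-complete h e′ D)))
code-complete (mu f) {xs} {y} {k} {r} (e-mu e below) D =
  ⇓-step (step-10 _ _ _) (loop y 0 (+-identityʳ y))
  where
  loop : ∀ d i → d + i ≡ y →
    cons (cons (code f) (cons (cons 11 (cons (code f) (cons i (encode xs)))) k)) (encode (i ∷ xs)) ⇓ r
  loop zero    i refl = code-complete f e (⇓-step (step-11-zero _ _ _ _) D)
  loop (suc d) i refl = code-complete f (proj₂ (below i (s≤s (m≤n+m i d))))
    (⇓-step (step-11-suc _ _ _ _ _) (loop d (suc i) (+-suc d i)))

-- From machine runs to a universal partial recursive program

iterate : ℕ → ℕ → ℕ
iterate zero    s = s
iterate (suc t) s = step (iterate t s)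

opaque
  iterate-computable : Computable₂ iterate
  iterate-computable = computable₂ iterateExp eq
    where
    iterateExp : Exp 2
    iterateExp = rec (var 0F) (step-computable · var 1F)
    eq : ∀ t s → ⟦ iterateExp ⟧ (t ∷ s ∷ []) ≡ iterate t s
    eq zero    s = refl
    eq (suc t) s = cong step (eq t s)

iterate-step : ∀ t s → iterate t (step s) ≡ step (iterate t s)
iterate-step zero    s = refl
iterate-step (suc t) s = cong step (iterate-step t s)

iterate⇒Halts : ∀ t s → hd (iterate t s) ≡ 0 → (∀ i → i < t → hd (iterate i s) ≢ 0) → Halts t s (tl (iterate t s))
iterate⇒Halts zero    s stop go = halt stop
iterate⇒Halts (suc t) s stop go rewrite sym (iterate-step t s) =
  tick (go 0 (s≤s z≤n)) (iterate⇒Halts t (step s) stop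
    λ i i<t eq → go (suc i) (s≤s i<t) (trans (cong hd (sym (iterate-step i s))) eq))

Halts⇒iterate : ∀ {t s r} → Halts t s r →
  hd (iterate t s) ≡ 0 × tl (iterate t s) ≡ r × (∀ i → i < t → hd (iterate i s) ≢ 0)
Halts⇒iterate (halt eq) = eq , refl , λ _ ()
Halts⇒iterate {suc t} {s} (tick go H) with stop , res , go′ ← Halts⇒iterate H =
  trans (cong hd (sym (iterate-step t s))) stop ,
  trans (cong tl (sym (iterate-step t s))) res ,
  λ { zero _ → go ; (suc i) (s≤s i<t) eq → go′ i i<t (trans (cong hd (iterate-step i s)) eq) }

Eval-suc : ∀ {z} {p : PR n} {xs} → z ≢ 0 → Eval p xs z → ∃ λ z′ → Eval p xs (suc z′)
Eval-suc {z = zero}  z≢0 ev = contradiction refl z≢0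
Eval-suc {z = suc z} _   ev = z , ev

init : ℕ → ℕ → ℕ → ℕ
init p e x = cons (cons p 0) (encode (e ∷ x ∷ []))

trace : Exp 4
trace = iterate-computable ·₂ var 0F ,
  cons′ (cons′ (var 1F) (const 0)) (cons′ (var 2F) (cons′ (var 3F) (const 0)))

opaque
  hd-trace-computable : Computable₄ λ t p e x → hd (iterate t (init p e x))
  hd-trace-computable = prog (hd′ trace) , λ t p e x → runs (hd′ trace) (t ∷ p ∷ e ∷ x ∷ [])

  tl-trace-computable : Computable₄ λ t p e x → tl (iterate t (init p e x))
  tl-trace-computable = prog (tl′ trace) , λ t p e x → runs (tl′ trace) (t ∷ p ∷ e ∷ x ∷ [])

opaque
  -- Kleene's normal form: minimise the halting time, then read the value off the final state.
  univ : PR 3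
  univ = comp (proj₁ tl-trace-computable)
    (lookup (mu (proj₁ hd-trace-computable) ∷ proj 0F ∷ proj 1F ∷ proj 2F ∷ []))

  univ-complete : ∀ (q : PR 2) {e x y} → Eval q (e ∷ x ∷ []) y → Eval univ (code q ∷ e ∷ x ∷ []) y
  univ-complete q {e} {x} {y} ev
    -- Over the empty stack 0 the state `cons 0 y` has already halted, with result y.
    with t , H ← code-complete q {k = 0} ev (0 , halt (hd-cons 0 y))
    with stop , res , go ← Halts⇒iterate H =
    e-comp (t ∷ code q ∷ e ∷ x ∷ [])
      (λ { 0F → e-mu (subst (Eval (proj₁ hd-trace-computable) _) stop (proj₂ hd-trace-computable t _ _ _))
                  λ i i<t → Eval-suc (go i i<t) (proj₂ hd-trace-computable i _ _ _)
         ; 1F → e-proj ; 2F → e-proj ; 3F → e-proj })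
      (subst (Eval (proj₁ tl-trace-computable) _) (trans res (tl-cons 0 y)) (proj₂ tl-trace-computable t _ _ _))

  univ-sound : ∀ (q : PR 2) {e x y} → Eval univ (code q ∷ e ∷ x ∷ []) y → Eval q (e ∷ x ∷ []) y
  univ-sound q {e} {x} {y} (e-comp (t ∷ p ∷ e′ ∷ x′ ∷ []) evs ev)
    with e-proj ← evs 1F | e-proj ← evs 2F | e-proj ← evs 3F | e-mu stop go ← evs 0F
    with y′ , ev′ , _ , _ , H′ ← code-sound q (e ∷ x ∷ []) {k = 0}
           (iterate⇒Halts t (init (code q) e x)
             (Eval-deterministic _ (proj₂ hd-trace-computable t _ _ _) stop)
             λ i i<t eq → 1+n≢0 (trans
               (Eval-deterministic _ (proj₂ (go i i<t)) (proj₂ hd-trace-computable i _ _ _)) eq)) =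
    subst (Eval q _) (trans (result H′) (Eval-deterministic _ (proj₂ tl-trace-computable t _ _ _) ev)) ev′
    where
    result : ∀ {t y r} → Halts t (cons 0 y) r → y ≡ r
    result {y = y} (halt _)    = sym (tl-cons 0 y)
    result {y = y} (tick go _) = contradiction (hd-cons 0 y) go

-- Membership in coded lists

codeList-∷ : ∀ x xs → codeList (x ∷ xs) ≡ cons x (codeList xs)
codeList-∷ x xs = sym (cons≡ x (codeList xs))

-- Allows `member` to use the code of the list as its own scanning bound.
length≤codeList : ∀ xs → length xs ≤ codeList xs
length≤codeList []       = z≤n
length≤codeList (x ∷ xs) rewrite codeList-∷ x xs =
  ≤-trans (s≤s (length≤codeList xs)) (≤-trans (s≤s (m≤n+m _ x)) (x+y<cons x (codeList xs)))

tails : ℕ → ℕ → ℕ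
tails l zero    = l
tails l (suc i) = tl (tails l i)

tails-codeList : ∀ xs i → tails (codeList xs) i ≡ codeList (drop i xs)
tails-codeList xs zero = refl
tails-codeList xs (suc i) = trans (cong tl (tails-codeList xs i)) (tl-drop i xs)
  where
  tl-drop : ∀ i xs → tl (codeList (drop i xs)) ≡ codeList (drop (suc i) xs)
  tl-drop zero    []       = tl-0
  tl-drop (suc i) []       = tl-0
  tl-drop zero    (x ∷ xs) = trans (cong tl (codeList-∷ x xs)) (tl-cons x _)
  tl-drop (suc i) (x ∷ xs) = tl-drop i xs

-- The two truncated differences vanish together exactly for equal numbers. The guard on l matters:
-- `hd 0` is 0, so the empty list would otherwise appear to contain 0.
hit : ℕ → ℕ → ℕ
hit j l = ifz l 0 (ifz ((hd l ∸ j) + (j ∸ hd l)) 1 0)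

-- the number of occurrences of j among the first i entries of the list coded by l
occurrences : ℕ → ℕ → ℕ → ℕ
occurrences j l zero    = 0
occurrences j l (suc i) = hit j (tails l i) + occurrences j l i

member : ℕ → ℕ → ℕ
member j l = occurrences j l l

opaque
  tails-computable : Computable₂ tails
  tails-computable = computable₂ tailsExp eq
    where
    tailsExp : Exp 2
    tailsExp = rec (var 0F) (tl′ (var 1F)) $$ (var 1F ∷ var 0F ∷ [])
    eq : ∀ l i → ⟦ tailsExp ⟧ (l ∷ i ∷ []) ≡ tails l i
    eq l zero    = refl
    eq l (suc i) = cong tl (eq l i)

opaque
  hit-computable : Computable₂ hit
  hit-computable = computable₂ (if-zero l (const 0) (if-zero distance (const 1) (const 0))) λ _ _ → refl
    where
    j l distance : Exp 2
    j = var 0F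
    l = var 1F
    distance = +-computable ·₂ (∸-computable ·₂ hd′ l , j) , (∸-computable ·₂ j , hd′ l)

opaque
  member-computable : Computable₂ member
  member-computable = computable₂ (occurrencesExp $$ (var 1F ∷ var 0F ∷ var 1F ∷ [])) λ j l → eq j l l
    where
    occurrencesExp : Exp 3
    occurrencesExp = rec (const 0)
      (+-computable ·₂ (hit-computable ·₂ var 2F , (tails-computable ·₂ var 3F , var 0F)) , var 1F)
    eq : ∀ j l i → ⟦ occurrencesExp ⟧ (i ∷ j ∷ l ∷ []) ≡ occurrences j l i
    eq j l zero    = refl
    eq j l (suc i) = cong (hit j (tails l i) +_) (eq j l i)

hit-head : ∀ x xs → hit x (codeList (x ∷ xs)) ≡ 1
hit-head x xs rewrite codeList-∷ x xs | hd-cons x (codeList xs) | n∸n≡0 x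
  with cons x (codeList xs) | cons≢0 x (codeList xs)
... | zero  | ≢0 = contradiction refl ≢0
... | suc _ | _  = refl

hit-∉ : ∀ j xs → j ∉ xs → hit j (codeList xs) ≡ 0
hit-∉ j []       j∉xs = refl
hit-∉ j (x ∷ xs) j∉xs rewrite codeList-∷ x xs | hd-cons x (codeList xs)
  with cons x (codeList xs)
... | zero  = refl
... | suc _ with (x ∸ j) + (j ∸ x) in eq
... | suc _ = refl
... | zero  = contradiction
  (here (≤-antisym (m∸n≡0⇒m≤n (m+n≡0⇒n≡0 (x ∸ j) eq)) (m∸n≡0⇒m≤n (m+n≡0⇒m≡0 (x ∸ j) eq)))) j∉xs

drop-⊆ : ∀ i {j} (xs : List ℕ) → j ∈ drop i xs → j ∈ xs
drop-⊆ zero    xs       j∈ = j∈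
drop-⊆ (suc i) (x ∷ xs) j∈ = there (drop-⊆ i xs j∈)

member-∉ : ∀ {j xs} → j ∉ xs → member j (codeList xs) ≡ 0
member-∉ {j} {xs} j∉xs = none (codeList xs)
  where
  none : ∀ i → occurrences j (codeList xs) i ≡ 0
  none zero = refl
  none (suc i) rewrite tails-codeList xs i | hit-∉ j (drop i xs) (λ j∈ → j∉xs (drop-⊆ i xs j∈)) = none i

∈⇒drop : ∀ {j : ℕ} {xs} → j ∈ xs → Σ ℕ λ i → i < length xs × Σ (List ℕ) λ ys → drop i xs ≡ j ∷ ys
∈⇒drop (here refl) = 0 , z<s , _ , refl
∈⇒drop (there j∈)  = let i , i< , ys , eq = ∈⇒drop j∈ in suc i , s<s i< , ys , eq

member-∈ : ∀ {j xs} → j ∈ xs → member j (codeList xs) ≢ 0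
member-∈ {j} {xs} j∈xs with i , i<len , ys , eq ← ∈⇒drop j∈xs =
  occurs (codeList xs) (≤-trans i<len (length≤codeList xs))
  where
  occurs : ∀ m → i < m → occurrences j (codeList xs) m ≢ 0
  occurs (suc m) (s≤s i≤m) eq′ with m≤n⇒m<n∨m≡n i≤m
  ... | inj₁ i<m  = occurs m i<m (m+n≡0⇒n≡0 (hit j (tails (codeList xs) m)) eq′)
  ... | inj₂ refl = 0≢1+n (trans (sym (m+n≡0⇒m≡0 (hit j (tails (codeList xs) m)) eq′))
    (trans (cong (hit j) (trans (tails-codeList xs m) (cong codeList eq))) (hit-head j ys)))

-- Greedy choice

leastFailure : ∀ {P : ℕ → Set} → Decidable P → ∀ n →
  (∀ k → k < n → P k) ⊎ Σ ℕ λ k → k < n × ¬ P k × (∀ i → i < k → P i)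
leastFailure P? zero = inj₁ λ _ ()
leastFailure P? (suc n) with leastFailure P? n
... | inj₂ (k , k<n , rest) = inj₂ (k , m<n⇒m<1+n k<n , rest)
... | inj₁ below with P? n
...   | no ¬Pn = inj₂ (n , ≤-refl , ¬Pn , below)
...   | yes Pn = inj₁ λ { k (s≤s k≤n) → case (m≤n⇒m<n∨m≡n k≤n) }
  where
  case : ∀ {k} → k < n ⊎ k ≡ n → _
  case (inj₁ k<n)  = below _ k<n
  case (inj₂ refl) = Pn

-- If the first `suc (length xs)` even numbers all occurred in xs, two of them would share a
-- position.
leastUnused : ∀ xs → Σ ℕ λ k → k ≤ length xs × double k ∉ xs × (∀ i → i < k → double i ∈ xs)
leastUnused xs with leastFailure (λ k → double k ∈? xs) (suc (length xs))
... | inj₂ (k , s≤s k≤len , rest) = k , k≤len , rest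
... | inj₁ all = contradiction same (<⇒≢ (proj₁ (proj₂ (proj₂ collision))))
  where
  member-of : ∀ i → double (toℕ i) ∈ xs
  member-of i = all (toℕ i) (toℕ<n i)
  collision = pigeonhole ≤-refl (λ i → index (member-of i))
  i₁ = proj₁ collision
  i₂ = proj₁ (proj₂ collision)
  same : toℕ i₁ ≡ toℕ i₂
  same = double-injective (trans (lookup-index (member-of i₁))
    (trans (cong (List.lookup xs) (proj₂ (proj₂ (proj₂ collision)))) (sym (lookup-index (member-of i₂)))))

module Greedy (g : ℕ → List ℕ) where

  -- Carried as a whole list, newest first: each choice depends on all earlier ones, and the current
  -- one can be read off the head.
  chosen : ℕ → List ℕ
  choice : ℕ → ℕ
  chosen zero    = []
  chosen (suc b) = double (choice b) ∷ chosen b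
  choice b = proj₁ (leastUnused (g b ++ chosen b))

  length-chosen : ∀ b → length (chosen b) ≡ b
  length-chosen zero    = refl
  length-chosen (suc b) = cong suc (length-chosen b)

  choice-≤ : ∀ b → choice b ≤ length (g b) + b
  choice-≤ b = ≤-trans (proj₁ (proj₂ (leastUnused (g b ++ chosen b))))
    (≤-reflexive (trans (length-++ (g b)) (cong (length (g b) +_) (length-chosen b))))

  choice-∉ : ∀ b → double (choice b) ∉ g b
  choice-∉ b = proj₁ (proj₂ (proj₂ (leastUnused (g b ++ chosen b)))) ∘ ∈-++⁺ˡ

  chosen-∈ : ∀ {a b} → a < b → double (choice a) ∈ chosen b
  chosen-∈ {a} {suc b} (s≤s a≤b) with m≤n⇒m<n∨m≡n a≤b
  ... | inj₁ a<b  = there (chosen-∈ a<b)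
  ... | inj₂ refl = here refl

  choice-distinct : ∀ {a b} → a < b → double (choice a) ≢ double (choice b)
  choice-distinct {a} {b} a<b eq = proj₁ (proj₂ (proj₂ (leastUnused (g b ++ chosen b))))
    (∈-++⁺ʳ (g b) (subst (_∈ chosen b) eq (chosen-∈ a<b)))

-- The diagonal program

index-in-block : ℕ → ℕ → ℕ
index-in-block A b = suc (double (double (A + b)))

unusedTest : Exp 3
unusedTest = +-computable ·₂ (member-computable ·₂ (double-computable · var 0F) , var 1F) ,
                             (member-computable ·₂ (double-computable · var 0F) , var 2F)

opaque
  unused : PR 2
  unused = mu (prog unusedTest)

  unused-runs : ∀ xs ys → Eval unused (codeList xs ∷ codeList ys ∷ []) (proj₁ (leastUnused (xs ++ ys)))
  unused-runs xs ys with k , _ , k∉ , below ← leastUnused (xs ++ ys) =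
    e-mu (runs-at unusedTest (k ∷ codeList xs ∷ codeList ys ∷ [])
           (cong₂ _+_ (member-∉ {xs = xs} (k∉ ∘ ∈-++⁺ˡ)) (member-∉ {xs = ys} (k∉ ∘ ∈-++⁺ʳ xs))))
      λ i i<k → Eval-suc (λ eq → used i eq (∈-++⁻ xs (below i i<k)))
                  (runs unusedTest (i ∷ codeList xs ∷ codeList ys ∷ []))
    where
    used : ∀ i → member (double i) (codeList xs) + member (double i) (codeList ys) ≡ 0 →
      ¬ (double i ∈ xs ⊎ double i ∈ ys)
    used i eq (inj₁ ∈xs) = member-∈ ∈xs (m+n≡0⇒m≡0 _ eq)
    used i eq (inj₂ ∈ys) = member-∈ ∈ys (m+n≡0⇒n≡0 (member (double i) (codeList xs)) eq)

-- Unlike `_$$_`, this composes programs that may diverge, such as `univ` and searches by `mu`.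
callWith : ∀ {m} → PR m → Vec (PR n) m → PR n
callWith f gs = comp f (lookup gs)

blockIndex : Exp 4
blockIndex = suc′ (double-computable · (double-computable · (+-computable ·₂ var 2F , var 0F)))

opaque
  -- The inputs are b, A and a program code; the recursion on b accumulates the coded list of
  -- choices. Divergence of the simulated program is harmless, as ψ may be partial.
  selected : PR 3
  selected = prec (prog {2} (const 0))
    (callWith (proj₁ cons-computable)
      (callWith (proj₁ double-computable)
        (callWith unused
          (callWith univ (proj 3F ∷ prog blockIndex ∷ prog (const 0) ∷ [])
          ∷ proj 1F ∷ []) ∷ [])
      ∷ proj 1F ∷ []))

  selected-runs : ∀ (q : PR 2) A g → (∀ b → Eval q (index-in-block A b ∷ 0 ∷ []) (codeList (g b))) →
    ∀ b → Eval selected (b ∷ A ∷ code q ∷ []) (codeList (Greedy.chosen g b))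
  selected-runs q A g q-runs zero    = e-prec0 (runs (const 0) (A ∷ code q ∷ []))
  selected-runs q A g q-runs (suc b) = e-precS (selected-runs q A g q-runs b)
    (subst (Eval _ (b ∷ codeList (chosen b) ∷ A ∷ code q ∷ [])) (sym (codeList-∷ (double (choice b)) (chosen b)))
      (e-comp (double (choice b) ∷ codeList (chosen b) ∷ [])
        (λ { 0F → e-comp (choice b ∷ [])
                    (λ { 0F → e-comp (codeList (g b) ∷ codeList (chosen b) ∷ [])
                      (λ { 0F → e-comp (code q ∷ index-in-block A b ∷ 0 ∷ [])
                                  (λ { 0F → e-proj
                                     ; 1F → runs blockIndex (b ∷ codeList (chosen b) ∷ A ∷ code q ∷ [])
                                     ; 2F → runs (const 0) (b ∷ codeList (chosen b) ∷ A ∷ code q ∷ []) })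
                                  (univ-complete q (q-runs b))
                         ; 1F → e-proj })
                      (unused-runs (g b) (chosen b)) })
                    (proj₂ double-computable (choice b))
           ; 1F → e-proj })
        (proj₂ cons-computable (double (choice b)) (codeList (chosen b)))))
    where
    open Greedy g

-- With a the quotient of i by 4, this vanishes exactly when a < 2^(n+1); for a > 0 the least such n
-- is the number of the block containing a.
blockTest : Exp 3
blockTest = ∸-computable ·₂ suc′ (half-computable · (half-computable · var 1F)) , cons′ (suc′ (var 0F)) (const 0)

-- 2 ^ n
blockSize : Exp 3
blockSize = cons′ (var 0F) (const 0)

-- One more than b, because `chosen (suc b)` is the list with the choice for b at its head.
offset : Exp 3
offset = suc′ (∸-computable ·₂ (half-computable · (half-computable · var 1F)) , blockSize)

-- i ∸ (i ∸ m) = min (i, m) keeps the value at index i at most i, so that ψ_i is never the constant of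
-- a later even index.
truncate : Exp 2
truncate = ∸-computable ·₂ var 0F , (∸-computable ·₂ var 0F , hd′ (var 1F))

half-half-index : ∀ A b → half (half (index-in-block A b)) ≡ A + b
half-half-index A b = trans (cong half (half-1+double (double (A + b)))) (half-double (A + b))

cons-0-mono : ∀ {m n} → m ≤ n → cons m 0 ≤ cons n 0
cons-0-mono {m} {n} m≤n = subst₂ _≤_ (sym (cons≡ m 0)) (sym (cons≡ n 0)) (*-monoˡ-≤ 1 (^-monoʳ-≤ 2 m≤n))

opaque
  diagonal : PR 2
  diagonal = callWith (prog truncate) (proj 0F ∷
    callWith (callWith selected (prog offset ∷ prog blockSize ∷ prog (hd′ (var 0F)) ∷ []))
      (mu (prog blockTest) ∷ proj 0F ∷ proj 1F ∷ []) ∷ [])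

  -- Unconditional on purpose: it also covers blocks whose number names no list function, where
  -- nothing else is known about the value.
  diagonal-≤ : ∀ {i y v} → Eval diagonal (i ∷ y ∷ []) v → v ≤ i
  diagonal-≤ {i} (e-comp (j ∷ c ∷ []) evs ev) with e-proj ← evs 0F =
    subst (_≤ i) (Eval-deterministic (prog truncate) (runs truncate (i ∷ c ∷ [])) ev) (m∸n≤m i (i ∸ hd c))

  diagonal-runs : ∀ (q : PR 2) n g → hd n ≡ code q →
    (∀ b → Eval q (index-in-block (cons n 0) b ∷ 0 ∷ []) (codeList (g b))) →
    ∀ {b} y → b < cons n 0 → double (Greedy.choice g b) ≤ index-in-block (cons n 0) b →
    Eval diagonal (index-in-block (cons n 0) b ∷ y ∷ []) (double (Greedy.choice g b))
  diagonal-runs q n g hd≡ q-runs {b} y b<A j≤i =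
    e-comp (i ∷ codeList (chosen (suc b)) ∷ [])
      (λ { 0F → e-proj
         ; 1F → e-comp (n ∷ i ∷ y ∷ [])
             (λ { 0F → e-mu (runs-at blockTest (n ∷ i ∷ y ∷ []) found)
                         λ m m<n → Eval-suc (tooSmall m<n) (runs blockTest (m ∷ i ∷ y ∷ []))
                ; 1F → e-proj
                ; 2F → e-proj })
             (e-comp (suc b ∷ A ∷ code q ∷ [])
               (λ { 0F → runs-at offset (n ∷ i ∷ y ∷ [])
                           (cong suc (trans (cong (_∸ A) (half-half-index A b)) (m+n∸m≡n A b)))
                  ; 1F → runs blockSize (n ∷ i ∷ y ∷ [])
                  ; 2F → runs-at (hd′ (var 0F)) (n ∷ i ∷ y ∷ []) hd≡ })
               (selected-runs q A g q-runs (suc b))) })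
      (runs-at truncate (i ∷ codeList (chosen (suc b)) ∷ []) (trans
        (cong (λ z → i ∸ (i ∸ z)) (trans (cong hd (codeList-∷ (double (choice b)) (chosen b))) (hd-cons _ _)))
        (m∸[m∸n]≡n j≤i)))
    where
    open Greedy g
    A i : ℕ
    A = cons n 0
    i = index-in-block A b
    found : suc (half (half i)) ∸ cons (suc n) 0 ≡ 0
    found rewrite half-half-index A b | cons-suc n 0 = m≤n⇒m∸n≡0 (begin
      suc (A + b)  ≡⟨ sym (+-suc A b) ⟩
      A + suc b    ≤⟨ +-monoʳ-≤ A b<A ⟩
      A + A        ≡⟨ cong (A +_) (sym (+-identityʳ A)) ⟩
      2 * A        ≡⟨ sym (double≡2* A) ⟩
      double A     ∎)
      where open ≤-Reasoning
    tooSmall : ∀ {m} → m < n → suc (half (half i)) ∸ cons (suc m) 0 ≢ 0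
    tooSmall {m} m<n rewrite half-half-index A b = m>n⇒m∸n≢0 (s≤s (≤-trans (cons-0-mono m<n) (m≤m+n A b)))

-- The numbering

-- Index 4c + 3 runs program hd c on tl c, index 4a + 1 is diagonal, and even indices are constant.
programOf : ℕ → ℕ
programOf i = ifz (parity i) (code (proj {2} 0F)) (ifz (parity (half i)) (code diagonal) (hd (half (half i))))

-- Even and diagonal indices are handed themselves: the projection then yields the constant i, and
-- `diagonal` learns its own index.
argumentOf : ℕ → ℕ
argumentOf i = ifz (parity i) i (ifz (parity (half i)) i (tl (half (half i))))

opaque
  programOf-computable : Computable programOf
  programOf-computable = computable select λ i →
    -- The program codes are opaque numbers on which `const` is stuck, so its value comes from
    -- `⟦const⟧`.
    cong₂ (λ c d → ifz (parity i) c (ifz (parity (half i)) d (hd (half (half i)))))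
      (⟦const⟧ (code (proj {2} 0F)) (i ∷ [])) (⟦const⟧ (code diagonal) (i ∷ []))
    where
    i : Exp 1
    i = var 0F
    select : Exp 1
    select = if-zero (parity-computable · i) (const (code (proj {2} 0F)))
      (if-zero (parity-computable · (half-computable · i)) (const (code diagonal))
        (hd′ (half-computable · (half-computable · i))))

  argumentOf-computable : Computable argumentOf
  argumentOf-computable = computable (if-zero (parity-computable · i) i
    (if-zero (parity-computable · (half-computable · i)) i (tl′ (half-computable · (half-computable · i)))))
    λ _ → refl
    where
    i : Exp 1
    i = var 0F

programExp argumentExp : Exp 2
programExp  = programOf-computable · var 0F
argumentExp = argumentOf-computable · var 0F

opaque
  ψ : Numbering
  ψ = callWith univ (prog programExp ∷ prog argumentExp ∷ proj 1F ∷ [])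

  ψ⇔ : ∀ {i e} (q : PR 2) → programOf i ≡ code q → argumentOf i ≡ e →
    ∀ {x y} → (ψ ⟦ i ⟧ x ↓ y) ⇔ Eval q (e ∷ x ∷ []) y
  ψ⇔ {i} {e} q p≡ e≡ {x} {y} = mk⇔ sound complete
    where
    sound : ψ ⟦ i ⟧ x ↓ y → Eval q (e ∷ x ∷ []) y
    sound (e-comp (p′ ∷ e′ ∷ x′ ∷ []) evs ev)
      with refl ← Eval-deterministic _ (evs 0F) (runs-at programExp (i ∷ x ∷ []) p≡)
         | refl ← Eval-deterministic _ (evs 1F) (runs-at argumentExp (i ∷ x ∷ []) e≡)
         | e-proj ← evs 2F = univ-sound q ev
    complete : Eval q (e ∷ x ∷ []) y → ψ ⟦ i ⟧ x ↓ y
    complete ev = e-comp (code q ∷ e ∷ x ∷ [])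
      (λ { 0F → runs-at programExp (i ∷ x ∷ []) p≡
         ; 1F → runs-at argumentExp (i ∷ x ∷ []) e≡
         ; 2F → e-proj })
      (univ-complete q ev)

open Equivalence

ψ-double : ∀ k {x} → ψ ⟦ double k ⟧ x ↓ double k
ψ-double k = from (ψ⇔ (proj 0F) program argument) e-proj
  where
  program : programOf (double k) ≡ code (proj {2} 0F)
  program rewrite parity-double k = refl
  argument : argumentOf (double k) ≡ double k
  argument rewrite parity-double k = refl

ψ-diagonal : ∀ a {x y} → (ψ ⟦ suc (double (double a)) ⟧ x ↓ y) ⇔ Eval diagonal (suc (double (double a)) ∷ x ∷ []) y
ψ-diagonal a = ψ⇔ diagonal program argument
  where
  program : programOf (suc (double (double a))) ≡ code diagonal
  program rewrite parity-1+double (double a) | half-1+double (double a) | parity-double a = refl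
  argument : argumentOf (suc (double (double a))) ≡ suc (double (double a))
  argument rewrite parity-1+double (double a) | half-1+double (double a) | parity-double a = refl

ψ-code : ∀ (θ : PR 2) e {x y} → (ψ ⟦ suc (double (suc (double (cons (code θ) e)))) ⟧ x ↓ y) ⇔ (θ ⟦ e ⟧ x ↓ y)
ψ-code θ e = ψ⇔ θ program argument
  where
  c = cons (code θ) e
  program : programOf (suc (double (suc (double c)))) ≡ code θ
  program rewrite parity-1+double (suc (double c)) | half-1+double (suc (double c)) | parity-1+double c
    | half-1+double c = hd-cons (code θ) e
  argument : argumentOf (suc (double (suc (double c)))) ≡ e
  argument rewrite parity-1+double (suc (double c)) | half-1+double (suc (double c)) | parity-1+double c
    | half-1+double c = tl-cons (code θ) e

coded-index≡ : ∀ c → 1 + double (suc (double c)) ≡ 1 + 2 * suc (2 * c)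
coded-index≡ c = cong suc (trans (double≡2* (suc (double c))) (cong (λ z → 2 * suc z) (double≡2* c)))

-- With P = 2^(code θ) the translated index is 8Pe + 4P + 3; the bound with equal coefficients
-- exceeds it by 3e + 4P.
ψ-kolmogorov : IsKolmogorov ψ
ψ-kolmogorov θ = t , t-computable , 8 * 2 ^ code θ + 3 , <-≤-trans z<s (m≤n+m 3 (8 * 2 ^ code θ)) ,
  (λ e x y → ψ-code θ e) , t-≤
  where
  t : ℕ → ℕ
  t e = suc (double (suc (double (cons (code θ) e))))
  t-computable : Computable t
  t-computable = computable
    (suc′ (double-computable · suc′ (double-computable · cons′ (const (code θ)) (var 0F))))
    λ e → cong (λ p → suc (double (suc (double (cons p e))))) (⟦const⟧ (code θ) (e ∷ []))
  t-≤ : ∀ e → t e ≤ (8 * 2 ^ code θ + 3) * e + (8 * 2 ^ code θ + 3)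
  t-≤ e = begin
    t e                                                      ≡⟨ coded-index≡ (cons (code θ) e) ⟩
    suc (2 * suc (2 * cons (code θ) e))                      ≡⟨ cong (λ c → 1 + 2 * suc (2 * c)) (cons≡ (code θ) e) ⟩
    suc (2 * suc (2 * (P * (2 * e + 1))))                    ≤⟨ m≤m+n _ (3 * e + 4 * P) ⟩
    suc (2 * suc (2 * (P * (2 * e + 1)))) + (3 * e + 4 * P)  ≡⟨ arith P e ⟩
    (8 * P + 3) * e + (8 * P + 3)                            ∎
    where
    open ≤-Reasoning
    P = 2 ^ code θ
    arith : ∀ P e → suc (2 * suc (2 * (P * (2 * e + 1)))) + (3 * e + 4 * P) ≡ (8 * P + 3) * e + (8 * P + 3)
    arith = solve-∀

-- Counting in a block

index≡ : ∀ A b → index-in-block A b ≡ suc (4 * (A + b))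
index≡ A b = cong suc (trans (double≡2* _) (trans (cong (2 *_) (double≡2* (A + b))) (sym (*-assoc 2 2 (A + b)))))

pigeonhole-< : ∀ {m n} → m < n → (c : ∀ b → b < n → ℕ) → (∀ b b<n → c b b<n < m) →
  Σ ℕ λ a → Σ ℕ λ b → Σ (a < n) λ a<n → Σ (b < n) λ b<n → a < b × c a a<n ≡ c b b<n
pigeonhole-< m<n c c<m
  with a , b , a<b , same ← pigeonhole m<n (λ i → fromℕ< (c<m (toℕ i) (toℕ<n i))) =
  toℕ a , toℕ b , toℕ<n a , toℕ<n b , a<b , fromℕ<-injective _ _ _ _ same

-- Failure of minimality yields a smaller index only up to double negation; over a finite range
-- these double negations merge into one.
¬¬-∀< : ∀ {P : ℕ → Set} n → (∀ b → b < n → ¬ ¬ P b) → ¬ ¬ (∀ b → b < n → P b)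
¬¬-∀< zero    _  ¬all = ¬all λ _ ()
¬¬-∀< {P} (suc n) nn ¬all = ¬¬-∀< n (λ b b<n → nn b (m<n⇒m<1+n b<n)) λ below → nn n ≤-refl λ Pn →
  ¬all λ { b (s≤s b≤n) → last below Pn (m≤n⇒m<n∨m≡n b≤n) }
  where
  last : (∀ b → b < n → P b) → P n → ∀ {b} → b < n ⊎ b ≡ n → P b
  last below Pn (inj₁ b<n)  = below _ b<n
  last below Pn (inj₂ refl) = Pn

-- An even index outputs itself, and a diagonal index at most itself thanks to the truncation;
-- neither reaches j. Only residue 3 modulo 4 remains.
smaller-index-coded : ∀ {i j x} → ψ ⟦ i ⟧ x ↓ j → i < j → Σ ℕ λ c → i ≡ suc (double (suc (double c)))
smaller-index-coded {i} {j} ev i<j with bisect i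
... | k , inj₁ refl = contradiction (Eval-deterministic ψ (ψ-double k) ev) (<⇒≢ i<j)
... | h , inj₂ refl with bisect h
... | a , inj₁ refl = contradiction (diagonal-≤ (to (ψ-diagonal a) ev)) (<⇒≱ i<j)
... | c , inj₂ refl = c , refl

module Block (f : ℕ → List ℕ) (f-computable : ComputableList f)
  (min∈f : ∀ x j → IsMin ψ x j → j ∈ f x) (N : ℕ) where

  -- `univ` simulates binary programs, so the unary program of f is given a second argument.
  q : PR 2
  q = comp (proj₁ f-computable) (λ _ → proj 0F)

  -- The first component selects the program that the block attacks; N in the second moves the block
  -- beyond N.
  level A : ℕ
  level = cons (code q) N
  A = cons level 0

  x : ℕ → ℕ
  x = index-in-block A

  open Greedy (λ b → f (x b))

  j : ℕ → ℕ
  j b = double (choice b)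

  N≤x : ∀ b → N ≤ x b
  N≤x b = begin
    N                ≤⟨ m≤n+m N (code q) ⟩
    code q + N       ≤⟨ <⇒≤ (x+y<cons (code q) N) ⟩
    level            ≤⟨ <⇒≤ (x<cons level 0) ⟩
    A                ≤⟨ m≤m+n A b ⟩
    A + b            ≤⟨ m≤n*m (A + b) 4 ⟩
    4 * (A + b)      ≤⟨ n≤1+n (4 * (A + b)) ⟩
    1 + 4 * (A + b)  ≡⟨ sym (index≡ A b) ⟩
    x b              ∎
    where open ≤-Reasoning

  Small : Set
  Small = ∀ b → b < A → x b > 8 * length (f (x b))

  module _ (small : Small) where

    -- Both |f(x)| and b are at most A - 1, and doubling their sum gives 4A - 4. The margin turns 4c
    -- + 3 < j into c + 1 < A.
    j-bound : ∀ {b} → b < A → j b + 4 ≤ 4 * A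
    j-bound {b} b<A = begin
      j b + 4                                   ≤⟨ +-monoˡ-≤ 4 (double-mono-≤ (choice-≤ b)) ⟩
      double (length (f (x b)) + b) + 4         ≡⟨ cong (_+ 4) (double≡2* _) ⟩
      2 * (length (f (x b)) + b) + 4            ≡⟨ arith (length (f (x b))) b ⟩
      2 * suc (length (f (x b))) + 2 * suc b    ≤⟨ +-mono-≤ (*-monoʳ-≤ 2 length<A) (*-monoʳ-≤ 2 b<A) ⟩
      2 * A + 2 * A                             ≡⟨ arith′ A ⟩
      4 * A                                     ∎
      where
      open ≤-Reasoning
      arith : ∀ l b → 2 * (l + b) + 4 ≡ 2 * suc l + 2 * suc b
      arith = solve-∀
      arith′ : ∀ A → 2 * A + 2 * A ≡ 4 * A
      arith′ = solve-∀
      arith″ : ∀ A b → 4 * (A + suc b) ≡ 4 + 4 * (A + b)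
      arith″ = solve-∀
      arith‴ : ∀ A → 4 * (A + A) ≡ 8 * A
      arith‴ = solve-∀
      -- Here the constant 8 is fixed: x is at most 4(2A - 1) + 1, which is below 8A.
      length<A : length (f (x b)) < A
      length<A = *-cancelˡ-< 8 _ _ (begin-strict
        8 * length (f (x b))  <⟨ small b b<A ⟩
        x b                   ≡⟨ index≡ A b ⟩
        1 + 4 * (A + b)       ≤⟨ +-monoˡ-≤ (4 * (A + b)) {1} {4} (s≤s z≤n) ⟩
        4 + 4 * (A + b)       ≡⟨ sym (arith″ A b) ⟩
        4 * (A + suc b)       ≤⟨ *-monoʳ-≤ 4 (+-monoʳ-≤ A b<A) ⟩
        4 * (A + A)           ≡⟨ arith‴ A ⟩
        8 * A                 ∎)

    ψ-x : ∀ {b y} → b < A → ψ ⟦ x b ⟧ y ↓ j b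
    ψ-x {b} {y} b<A = from (ψ-diagonal (A + b)) (diagonal-runs q level (λ b → f (x b)) (hd-cons _ _)
      (λ b → e-comp (x b ∷ []) (λ { 0F → e-proj }) (proj₂ f-computable (x b))) y b<A (begin
        j b              ≤⟨ m≤m+n (j b) 4 ⟩
        j b + 4          ≤⟨ j-bound b<A ⟩
        4 * A            ≤⟨ *-monoʳ-≤ 4 (m≤m+n A b) ⟩
        4 * (A + b)      ≤⟨ n≤1+n (4 * (A + b)) ⟩
        1 + 4 * (A + b)  ≡⟨ sym (index≡ A b) ⟩
        x b              ∎))
      where open ≤-Reasoning

    ψ-j∼ψ-x : ∀ {b} → b < A → SameFn ψ (j b) ψ (x b)
    ψ-j∼ψ-x {b} b<A y v = mk⇔
      (λ ev → subst (ψ ⟦ x b ⟧ y ↓_) (Eval-deterministic ψ (ψ-double (choice b)) ev) (ψ-x b<A))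
      (λ ev → subst (ψ ⟦ j b ⟧ y ↓_) (Eval-deterministic ψ (ψ-x b<A) ev) (ψ-double (choice b)))

    -- The bound `suc c < A` leaves A - 1 values of c, one fewer than the block has indices. The
    -- argument 0 suffices to tell constants apart.
    CodedBelow : ℕ → Set
    CodedBelow b = Σ ℕ λ c → suc c < A × ψ ⟦ suc (double (suc (double c))) ⟧ 0 ↓ j b

    -- If no simulation below j gave j, then j would be the minimal index for x, and f would have to
    -- list a number that the greedy choice avoids.
    ¬¬-coded : ∀ b → b < A → ¬ ¬ CodedBelow b
    ¬¬-coded b b<A ¬coded = choice-∉ b (min∈f (x b) (j b) (ψ-j∼ψ-x b<A , λ i i<j same →
      ¬coded (coded i<j (from (same 0 (j b)) (ψ-x b<A)))))
      where
      coded : ∀ {i} → i < j b → ψ ⟦ i ⟧ 0 ↓ j b → CodedBelow b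
      coded {i} i<j ev with c , refl ← smaller-index-coded ev i<j = c , *-cancelˡ-< 4 _ _ (begin-strict
        4 * suc c                             ≡⟨ arith c ⟩
        suc (2 * suc (2 * c)) + 1             ≡⟨ cong (_+ 1) (sym (coded-index≡ c)) ⟩
        suc (double (suc (double c))) + 1     <⟨ +-monoˡ-< 1 i<j ⟩
        j b + 1                               ≤⟨ +-monoʳ-≤ (j b) (s≤s z≤n) ⟩
        j b + 4                               ≤⟨ j-bound b<A ⟩
        4 * A                                 ∎) , ev
        where
        open ≤-Reasoning
        arith : ∀ c → 4 * suc c ≡ suc (2 * suc (2 * c)) + 1
        arith = solve-∀

    -- Two b sharing one c would make a single index output two distinct constants.
    ¬all-coded : ¬ (∀ b → b < A → CodedBelow b)
    ¬all-coded coded with a , b , a<A , b<A , a<b , same ← pigeonhole-<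
      (≤-reflexive (suc-pred A {{≢-nonZero (cons≢0 level 0)}}))
      (λ b b<A → proj₁ (coded b b<A)) (λ b b<A → pred-mono-≤ (proj₁ (proj₂ (coded b b<A)))) =
      choice-distinct a<b (Eval-deterministic ψ
        (subst (λ c → ψ ⟦ suc (double (suc (double c))) ⟧ 0 ↓ j a) same (proj₂ (proj₂ (coded a a<A))))
        (proj₂ (proj₂ (coded b b<A))))

    contradictory : ⊥
    contradictory = ¬¬-∀< A ¬¬-coded ¬all-coded

  -- The comparison is decidable on the finite block, so the witness comes from a search, and the
  -- double-negated argument only has to refute its absence.
  large-list : Σ ℕ λ y → N ≤ y × y ≤ 8 * length (f y)
  large-list with anyUpTo? (λ b → x b ≤? 8 * length (f (x b))) A
  ... | yes (b , _ , x≤) = x b , N≤x b , x≤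
  ... | no none = ⊥-elim (contradictory λ b b<A → ≰⇒> λ x≤ → none (b , b<A , x≤))

theorem4p6 : Σ Numbering λ ψ → IsKolmogorov ψ ×
    ((f : ℕ → List ℕ) → ComputableList f → (∀ x j → IsMin ψ x j → j ∈ f x) →
    Σ ℕ λ k → 0 < k × (∀ N → Σ ℕ λ x → N ≤ x × x ≤ k * length (f x)))
theorem4p6 = ψ , ψ-kolmogorov , λ f f-computable min∈f → 8 , z<s , Block.large-list f f-computable min∈f
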